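{- There is an absolute constant $K$ such that for every $n\ge2$, every function $f\colon S_n\to\{0,1\}$ of sensitivity $s$ can be computed by a circuit of size at most $n^{Ks}$.
   Context: The sensitivity of $f\colon S_n\to\{0,1\}$ at $\pi$, denoted $s(f,\pi)$, is the maximum number of pairwise disjoint transpositions $\tau_1,\dots,\tau_k\in S_n$ (no two of them move a common point) such that $f(\tau_j\pi)\neq f(\pi)$ for all $j$. The sensitivity of $f$ is $s=s(f)=\max_{\pi\in S_n}s(f,\pi)$. Circuits are Boolean circuits over the AND, OR, NOT basis with unbounded fan-in; size is the number of gates. The input to the circuit is the permutation matrix of $\pi$, that is, the $n^2$ bits $x_{i,j}$ ($1\le i,j\le n$), where $x_{i,j}=1$ if and only if $\pi(i)=j$. The circuit computes $f$ if it outputs $f(\pi)$ on the permutation matrix of $\pi$, for every $\pi\in S_n$ (its behavior on other inputs is irrelevant). -}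

module Defs where

open import Data.Bool.Base using (Bool; not)
open import Data.Bool.ListAction using (all; any)
open import Data.Fin.Base using (Fin; zero; suc)
open import Data.Fin.Permutation using (Permutation′; _⟨$⟩ʳ_; _≈_; _∘ₚ_; transpose)
open import Data.Fin.Properties using (_≟_)
open import Data.List.Base using (List)
open import Data.Nat.Base using (ℕ; zero; suc; _≤_)
open import Data.Product.Base using (∃; ∃-syntax; _×_; _,_)
open import Data.Sum.Base using (_⊎_; inj₁; inj₂; [_,_])
open import Relation.Binary.PropositionalEquality.Core using (_≡_; _≢_)
open import Relation.Nullary.Decidable.Core using (does)
open import Relation.Nullary.Negation.Core using (¬_)

private
  variable
    n k : ℕ

IsMaximum : (ℕ → Set) → ℕ → Set
IsMaximum P m = P m × (∀ k → P k → k ≤ m)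

IsTransposition : Permutation′ n → Set
IsTransposition τ = ∃[ i ] ∃[ j ] (i ≢ j × τ ≈ transpose i j)

Moves : Permutation′ n → Fin n → Set
Moves τ x = τ ⟨$⟩ʳ x ≢ x

Disjoint : Permutation′ n → Permutation′ n → Set
Disjoint τ σ = ∀ x → ¬ (Moves τ x × Moves σ x)

-- `_∘ₚ_` composes diagrammatically, so `π ∘ₚ τ` is the product τπ,
-- i ↦ τ(π(i)).
record SensitiveFamily (f : Permutation′ n → Bool) (π : Permutation′ n) (k : ℕ) : Set where
  field
    τ             : Fin k → Permutation′ n
    transposition : ∀ a → IsTransposition (τ a)
    disjoint      : ∀ a b → a ≢ b → Disjoint (τ a) (τ b)
    sensitive     : ∀ a → f (π ∘ₚ τ a) ≢ f π

-- `IsSensitivityAt f π m` says s(f,π) = m.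
IsSensitivityAt : (Permutation′ n → Bool) → Permutation′ n → ℕ → Set
IsSensitivityAt f π = IsMaximum (SensitiveFamily f π)

-- `IsSensitivity f s` says s(f) = s.
IsSensitivity : (Permutation′ n → Bool) → ℕ → Set
IsSensitivity f = IsMaximum (λ m → ∃[ π ] IsSensitivityAt f π m)

data Gate (W : Set) : Set where
  AND OR : List W → Gate W
  NOT    : W → Gate W

evalGate : {W : Set} → (W → Bool) → Gate W → Bool
evalGate v (AND ws) = all v ws
evalGate v (OR ws)  = any v ws
evalGate v (NOT w)  = not (v w)

-- `Gates I k` lists k gates in topological order; each may read the input
-- bits I and all earlier gates, with unrestricted fan-out.  As de Bruijn
-- indices, `zero : Fin (suc k)` is the gate added last.
data Gates (I : Set) : ℕ → Set where
  []  : Gates I zero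
  _▷_ : Gates I k → Gate (I ⊎ Fin k) → Gates I (suc k)

evalGates : {I : Set} → Gates I k → (I → Bool) → Fin k → Bool
evalGates (gs ▷ g) x zero    = evalGate [ x , evalGates gs x ] g
evalGates (gs ▷ g) x (suc i) = evalGates gs x i

record Circuit (I : Set) : Set where
  field
    size   : ℕ
    gates  : Gates I size
    output : I ⊎ Fin size

open Circuit public using (size)

evalCircuit : {I : Set} → Circuit I → (I → Bool) → Bool
evalCircuit C x = [ x , evalGates (Circuit.gates C) x ] (Circuit.output C)

permutationMatrix : Permutation′ n → Fin n × Fin n → Bool
permutationMatrix π (i , j) = does (π ⟨$⟩ʳ i ≟ j)

Computes : Circuit (Fin n × Fin n) → (Permutation′ n → Bool) → Set
Computes C f = ∀ π → evalCircuit C (permutationMatrix π) ≡ f π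

{-# OPTIONS --safe #-}

-- Let s be the sensitivity and measure permutations by the number of points
-- they move.  If σ moves more than 6s points, then among the transpositions
-- (i σ(i)) one finds 2s + 1 disjoint ones, each of which, multiplied onto σ,
-- leaves fewer moved points; at most s of them change f, so f(σρ) is the majority
-- of the values of f at points closer to ρ.  Hence the values of f on the
-- ball of radius 6s around a centre ρ determine those on the ball of radius
-- 6s + 2, which contains the ball of radius 6s around any τρ with τ a transposition.
-- The circuit moves the centre from the identity to the input π in n such
-- steps, the i-th of which makes the centre agree with π at i.

module Submission where

open import Data.Bool.Base using (Bool; true; false; _∧_; _∨_)
open import Data.Bool.ListAction using (any)
import Data.Bool.Properties as Bool
open import Data.Fin.Base using (Fin; zero; suc; fromℕ<)
open import Data.Fin.Permutation using (Permutation′; _⟨$⟩ʳ_; _⟨$⟩ˡ_; inverseˡ; _≈_; _∘ₚ_; transpose; id)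
open import Data.Fin.Properties using (_≟_; any?; injective⇒≤)
open import Data.Fin.Subset using (Subset; inside; outside; ⁅_⁆; _∪_; ∣_∣; _⊆_)
  renaming (_∈_ to _∈ˢ_; _∉_ to _∉ˢ_; ⊥ to ∅)
open import Data.Fin.Subset.Properties using (_∈?_; x∈⁅x⁆; x∈⁅y⁆⇒x≡y; ∣⁅x⁆∣≡1; p⊆q⇒∣p∣≤∣q∣; p⊂q⇒∣p∣<∣q∣; x∈p∪q⁺; ∣⊥∣≡0)
open import Data.List.Base using (List; []; _∷_; length; map; filter; allFin; cartesianProduct; cartesianProductWith; lookup)
open import Data.List.Membership.Propositional using (_∈_)
open import Data.List.Membership.Propositional.Properties using (∈-cartesianProductWith⁺; ∈-cartesianProduct⁺; ∈-allFin; ∈-lookup)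
open import Data.List.Properties using (map-cong; map-∘; length-++; length-map; length-tabulate)
open import Data.List.Relation.Unary.All as All using (All; []; _∷_)
import Data.List.Relation.Unary.All.Properties as All
open import Data.List.Relation.Unary.AllPairs using (AllPairs; []; _∷_)
import Data.List.Relation.Unary.AllPairs.Properties as AllPairs
open import Data.List.Relation.Unary.Any using (here; there)
open import Data.Nat.Base
open import Data.Nat.Properties hiding (_≟_)
open import Data.Nat.Solver using (module +-*-Solver)
open import Data.Product.Base using (∃-syntax; _×_; _,_; proj₁; proj₂; swap; map₂)
open import Data.Sum.Base using (_⊎_; inj₁; inj₂; [_,_])
open import Data.Unit.Base using (tt)
import Data.Vec.Base as Vec
open import Data.Vec.Properties using (lookup∘tabulate; []=⇒lookup; lookup⇒[]=)
open import Defs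
open import Function.Base using (_∘_)
open import Relation.Binary.Core using (_Preserves_⟶_)
open import Relation.Binary.PropositionalEquality using (_≡_; _≢_; refl; sym; trans; cong; cong₂; subst; ≢-sym; module ≡-Reasoning)
open import Relation.Nullary using (¬_; Dec; yes; no; does; contradiction; ¬?; _×-dec_)
open import Relation.Nullary.Decidable using (dec-true; dec-false; decidable-stable)
open import Relation.Unary using (Decidable)

private
  variable
    n m k s c d : ℕ
    A B : Set

-- Permutations and their supports

⟨$⟩ʳ-injective : (σ : Permutation′ n) {i j : Fin n} → σ ⟨$⟩ʳ i ≡ σ ⟨$⟩ʳ j → i ≡ j
⟨$⟩ʳ-injective σ {i} {j} eq = begin
  i                  ≡⟨ inverseˡ σ ⟨
  σ ⟨$⟩ˡ (σ ⟨$⟩ʳ i)  ≡⟨ cong (σ ⟨$⟩ˡ_) eq ⟩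
  σ ⟨$⟩ˡ (σ ⟨$⟩ʳ j)  ≡⟨ inverseˡ σ ⟩
  j                  ∎
  where open ≡-Reasoning

transpose-left : (i j : Fin n) → transpose i j ⟨$⟩ʳ i ≡ j
transpose-left i j rewrite dec-true (i ≟ i) refl = refl

transpose-right : (i j : Fin n) → transpose i j ⟨$⟩ʳ j ≡ i
transpose-right i j with j ≟ i
... | yes j≡i = j≡i
... | no _ rewrite dec-true (j ≟ j) refl = refl

transpose-other : {i j k : Fin n} → k ≢ i → k ≢ j → transpose i j ⟨$⟩ʳ k ≡ k
transpose-other {i = i} {j} {k} k≢i k≢j
  rewrite dec-false (k ≟ i) k≢i | dec-false (k ≟ j) k≢j = refl

transpose-trivial : (i k : Fin n) → transpose i i ⟨$⟩ʳ k ≡ k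
transpose-trivial i k with k ≟ i
... | yes refl = refl
... | no k≢i rewrite dec-false (k ≟ i) k≢i = refl

transpose-involutive : (i j k : Fin n) → transpose i j ⟨$⟩ʳ (transpose i j ⟨$⟩ʳ k) ≡ k
transpose-involutive i j k with k ≟ i
... | yes refl = transpose-right k j
... | no k≢i with k ≟ j
...   | yes refl = transpose-left i k
...   | no k≢j = transpose-other k≢i k≢j

transpose-moves : (i j : Fin n) {x : Fin n} → Moves (transpose i j) x → x ≡ i ⊎ x ≡ j
transpose-moves i j {x} moves = decide (x ≟ i) (x ≟ j)
  where
  decide : Dec (x ≡ i) → Dec (x ≡ j) → x ≡ i ⊎ x ≡ j
  decide (yes x≡i) _         = inj₁ x≡i
  decide (no _)    (yes x≡j) = inj₂ x≡j
  decide (no x≢i)  (no x≢j)  = contradiction (transpose-other x≢i x≢j) moves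

moves? : (σ : Permutation′ n) → Decidable (Moves σ)
moves? σ i = ¬? (σ ⟨$⟩ʳ i ≟ i)

support : Permutation′ n → Subset n
support σ = Vec.tabulate (λ i → does (moves? σ i))

∈-support⁺ : (σ : Permutation′ n) {i : Fin n} → Moves σ i → i ∈ˢ support σ
∈-support⁺ σ {i} moves = lookup⇒[]= i (support σ)
  (trans (lookup∘tabulate _ i) (dec-true (moves? σ i) moves))

∈-support⁻ : (σ : Permutation′ n) {i : Fin n} → i ∈ˢ support σ → Moves σ i
∈-support⁻ σ {i} i∈ fixes
  with () ← trans (sym (dec-false (moves? σ i) (λ moves → moves fixes)))
                  (trans (sym (lookup∘tabulate _ i)) ([]=⇒lookup i∈))

∣p∪q∣≤∣p∣+∣q∣ : (p q : Subset n) → ∣ p ∪ q ∣ ≤ ∣ p ∣ + ∣ q ∣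
∣p∪q∣≤∣p∣+∣q∣ Vec.[] Vec.[] = z≤n
∣p∪q∣≤∣p∣+∣q∣ (outside Vec.∷ p) (outside Vec.∷ q) = ∣p∪q∣≤∣p∣+∣q∣ p q
∣p∪q∣≤∣p∣+∣q∣ (inside  Vec.∷ p) (outside Vec.∷ q) = s≤s (∣p∪q∣≤∣p∣+∣q∣ p q)
∣p∪q∣≤∣p∣+∣q∣ (outside Vec.∷ p) (inside  Vec.∷ q) =
  ≤-trans (s≤s (∣p∪q∣≤∣p∣+∣q∣ p q)) (≤-reflexive (sym (+-suc ∣ p ∣ ∣ q ∣)))
∣p∪q∣≤∣p∣+∣q∣ (inside  Vec.∷ p) (inside  Vec.∷ q) =
  s≤s (≤-trans (∣p∪q∣≤∣p∣+∣q∣ p q) (+-monoʳ-≤ ∣ p ∣ (n≤1+n ∣ q ∣)))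

∣⁅x⁆∪p∣≤1+∣p∣ : (x : Fin n) (p : Subset n) → ∣ ⁅ x ⁆ ∪ p ∣ ≤ suc ∣ p ∣
∣⁅x⁆∪p∣≤1+∣p∣ x p = ≤-trans (∣p∪q∣≤∣p∣+∣q∣ ⁅ x ⁆ p) (≤-reflexive (cong (_+ ∣ p ∣) (∣⁅x⁆∣≡1 x)))

support-id : (n : ℕ) → ∣ support (id {n}) ∣ ≤ 0
support-id n = ≤-trans
  (p⊆q⇒∣p∣≤∣q∣ {p = support id} {q = ∅ {n}} (λ i∈ → contradiction refl (∈-support⁻ id i∈)))
  (≤-reflexive (∣⊥∣≡0 n))

-- Puts the ball of radius `r` around a centre shifted by one transposition inside the ball of
-- radius `r + 2` around the old centre.
support-transpose-∘ₚ : (i j : Fin n) (σ : Permutation′ n) →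
  ∣ support (transpose i j ∘ₚ σ) ∣ ≤ 2 + ∣ support σ ∣
support-transpose-∘ₚ i j σ = begin
  ∣ support (transpose i j ∘ₚ σ) ∣     ≤⟨ p⊆q⇒∣p∣≤∣q∣ covered ⟩
  ∣ ⁅ i ⁆ ∪ (⁅ j ⁆ ∪ support σ) ∣     ≤⟨ ∣⁅x⁆∪p∣≤1+∣p∣ i _ ⟩
  1 + ∣ ⁅ j ⁆ ∪ support σ ∣           ≤⟨ s≤s (∣⁅x⁆∪p∣≤1+∣p∣ j _) ⟩
  2 + ∣ support σ ∣                   ∎
  where
  open ≤-Reasoning
  covered : support (transpose i j ∘ₚ σ) ⊆ ⁅ i ⁆ ∪ (⁅ j ⁆ ∪ support σ)
  covered {x} x∈ with x ≟ i | x ≟ j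
  ... | yes refl | _        = x∈p∪q⁺ (inj₁ (x∈⁅x⁆ x))
  ... | no _     | yes refl = x∈p∪q⁺ (inj₂ (x∈p∪q⁺ (inj₁ (x∈⁅x⁆ x))))
  ... | no x≢i   | no x≢j   = x∈p∪q⁺ (inj₂ (x∈p∪q⁺ (inj₂ (∈-support⁺ σ λ σx≡x →
    ∈-support⁻ (transpose i j ∘ₚ σ) x∈ (trans (cong (σ ⟨$⟩ʳ_) (transpose-other x≢i x≢j)) σx≡x)))))

-- Transpositions that bring a permutation closer to the identity

settler : Permutation′ n → Fin n → Permutation′ n
settler σ i = transpose i (σ ⟨$⟩ʳ i)

settler-settles : (σ : Permutation′ n) (i : Fin n) → (σ ∘ₚ settler σ i) ⟨$⟩ʳ i ≡ i
settler-settles σ i = transpose-right i (σ ⟨$⟩ʳ i)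

-- By injectivity a fixed point `k` other than `i` also differs from `σ i`, so the transposition
-- does not touch it.
settler-keeps : (σ : Permutation′ n) (i : Fin n) {k : Fin n} →
  σ ⟨$⟩ʳ k ≡ k → (σ ∘ₚ settler σ i) ⟨$⟩ʳ k ≡ k
settler-keeps σ i {k} σk≡k with k ≟ i
... | yes refl = settler-settles σ k
... | no k≢i = trans (cong (settler σ i ⟨$⟩ʳ_) σk≡k)
  (transpose-other k≢i (λ k≡σi → k≢i (⟨$⟩ʳ-injective σ (trans σk≡k k≡σi))))

support-settle : (σ : Permutation′ n) (i : Fin n) → Moves σ i →
  ∣ support (σ ∘ₚ settler σ i) ∣ < ∣ support σ ∣
support-settle σ i moves = p⊂q⇒∣p∣<∣q∣
  ( (λ x∈ → ∈-support⁺ σ (∈-support⁻ (σ ∘ₚ settler σ i) x∈ ∘ settler-keeps σ i))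
  , i , ∈-support⁺ σ moves
  , λ i∈ → ∈-support⁻ (σ ∘ₚ settler σ i) i∈ (settler-settles σ i))

blocked : Permutation′ n → List (Fin n) → Subset n
blocked σ []       = ∅
blocked σ (j ∷ js) = ⁅ j ⁆ ∪ (⁅ σ ⟨$⟩ʳ j ⁆ ∪ (⁅ σ ⟨$⟩ˡ j ⁆ ∪ blocked σ js))

∣blocked∣ : (σ : Permutation′ n) (js : List (Fin n)) → ∣ blocked σ js ∣ ≤ 3 * length js
∣blocked∣ {n} σ [] = ≤-reflexive (∣⊥∣≡0 n)
∣blocked∣ σ (j ∷ js) = begin
  ∣ blocked σ (j ∷ js) ∣  ≤⟨ ∣⁅x⁆∪p∣≤1+∣p∣ j _ ⟩
  1 + _                   ≤⟨ s≤s (∣⁅x⁆∪p∣≤1+∣p∣ (σ ⟨$⟩ʳ j) _) ⟩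
  2 + _                   ≤⟨ s≤s (s≤s (∣⁅x⁆∪p∣≤1+∣p∣ (σ ⟨$⟩ˡ j) _)) ⟩
  3 + ∣ blocked σ js ∣    ≤⟨ +-monoʳ-≤ 3 (∣blocked∣ σ js) ⟩
  3 + 3 * length js       ≡⟨ *-suc 3 (length js) ⟨
  3 * suc (length js)     ∎
  where open ≤-Reasoning

SettlersDisjoint : Permutation′ n → Fin n → Fin n → Set
SettlersDisjoint σ i j = Disjoint (settler σ i) (settler σ j)

-- A common point is `i` or `σ i`, and also `j` or `σ j`. The four cases make `i` equal to `j`,
-- `σ j`, `σ⁻¹ j` or, by injectivity, `j` again.
unblocked-disjoint : (σ : Permutation′ n) {i : Fin n} (js : List (Fin n)) →
  i ∉ˢ blocked σ js → All (SettlersDisjoint σ i) js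
unblocked-disjoint σ [] _ = []
unblocked-disjoint σ {i} (j ∷ js) i∉ =
  disjoint ∷ unblocked-disjoint σ js
    (λ i∈ → i∉ (x∈p∪q⁺ (inj₂ (x∈p∪q⁺ (inj₂ (x∈p∪q⁺ (inj₂ i∈)))))))
  where
  i≢j : i ≢ j
  i≢j refl = i∉ (x∈p∪q⁺ (inj₁ (x∈⁅x⁆ i)))
  i≢σj : i ≢ σ ⟨$⟩ʳ j
  i≢σj refl = i∉ (x∈p∪q⁺ (inj₂ (x∈p∪q⁺ (inj₁ (x∈⁅x⁆ i)))))
  i≢σ⁻¹j : i ≢ σ ⟨$⟩ˡ j
  i≢σ⁻¹j refl = i∉ (x∈p∪q⁺ (inj₂ (x∈p∪q⁺ (inj₂ (x∈p∪q⁺ (inj₁ (x∈⁅x⁆ i)))))))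
  disjoint : SettlersDisjoint σ i j
  disjoint x (p , q)
    with transpose-moves i (σ ⟨$⟩ʳ i) p | transpose-moves j (σ ⟨$⟩ʳ j) q
  ... | inj₁ x≡i  | inj₁ x≡j  = i≢j (trans (sym x≡i) x≡j)
  ... | inj₁ x≡i  | inj₂ x≡σj = i≢σj (trans (sym x≡i) x≡σj)
  ... | inj₂ x≡σi | inj₁ x≡j  = i≢σ⁻¹j
    (trans (sym (inverseˡ σ)) (cong (σ ⟨$⟩ˡ_) (trans (sym x≡σi) x≡j)))
  ... | inj₂ x≡σi | inj₂ x≡σj = i≢j (⟨$⟩ʳ-injective σ (trans (sym x≡σi) x≡σj))

-- Greedy choice: (i σi) meets (j σj) only if i ∈ {j, σj, σ⁻¹j}, so each
-- chosen point blocks at most three points.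
settlers : (σ : Permutation′ n) (k : ℕ) →
  (∃[ is ] (length is ≡ k × All (Moves σ) is × AllPairs (SettlersDisjoint σ) is))
  ⊎ 3 + ∣ support σ ∣ ≤ 3 * k
settlers σ zero = inj₁ ([] , refl , [] , [])
settlers σ (suc k) with settlers σ k
... | inj₂ small = inj₂ (≤-trans small (*-monoʳ-≤ 3 (n≤1+n k)))
... | inj₁ (is , refl , moves , disjoint)
  with any? (λ i → moves? σ i ×-dec ¬? (i ∈? blocked σ is))
...   | yes (i , moves-i , i∉) =
  inj₁ (i ∷ is , refl , moves-i ∷ moves , unblocked-disjoint σ is i∉ ∷ disjoint)
-- Every moved point is blocked, and each point of `is` blocks at most three. The summand 3 on both
-- sides avoids a subtraction.
...   | no none = inj₂ (begin
  3 + ∣ support σ ∣     ≤⟨ +-monoʳ-≤ 3 (p⊆q⇒∣p∣≤∣q∣ covered) ⟩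
  3 + ∣ blocked σ is ∣  ≤⟨ +-monoʳ-≤ 3 (∣blocked∣ σ is) ⟩
  3 + 3 * length is     ≡⟨ *-suc 3 (length is) ⟨
  3 * suc (length is)   ∎)
  where
  open ≤-Reasoning
  covered : support σ ⊆ blocked σ is
  covered {x} x∈ = decidable-stable (x ∈? blocked σ is)
    (λ x∉ → none (x , ∈-support⁻ σ x∈ , x∉))

settler-transposition : (σ : Permutation′ n) {i : Fin n} → Moves σ i → IsTransposition (settler σ i)
settler-transposition σ {i} moves = i , σ ⟨$⟩ʳ i , ≢-sym moves , λ _ → refl

-- Listing the permutations with small support

pairs : (n : ℕ) → List (Fin n × Fin n)
pairs n = cartesianProduct (allFin n) (allFin n)

length-cartesianProductWith : {C : Set} (g : A → B → C) (xs : List A) (ys : List B) →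
  length (cartesianProductWith g xs ys) ≡ length xs * length ys
length-cartesianProductWith g [] ys = refl
length-cartesianProductWith g (x ∷ xs) ys = trans (length-++ (map (g x) ys))
  (cong₂ _+_ (length-map (g x) ys) (length-cartesianProductWith g xs ys))

length-pairs : (n : ℕ) → length (pairs n) ≡ n * n
length-pairs n = trans (length-cartesianProductWith _,_ (allFin n) (allFin n))
  (cong (λ l → l * l) (length-tabulate {n = n} λ i → i))

∈-pairs : (i j : Fin n) → (i , j) ∈ pairs n
∈-pairs i j = ∈-cartesianProduct⁺ (∈-allFin i) (∈-allFin j)

-- The case `i = j` is included: such trivial factors pad shorter products to exactly `m` factors.
products : (n m : ℕ) → List (Permutation′ n)
products n zero    = id ∷ []
products n (suc m) =
  cartesianProductWith (λ { (i , j) σ → σ ∘ₚ transpose i j }) (pairs n) (products n m)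

length-products : (n m : ℕ) → length (products n m) ≡ (n * n) ^ m
length-products n zero    = refl
length-products n (suc m) = trans (length-cartesianProductWith _ (pairs n) (products n m))
  (cong₂ _*_ (length-pairs n) (length-products n m))

-- Settling a moved point shrinks the support, and the settler, an involution, is multiplied back as
-- the last factor. Once no point moves, trivial factors at `i₀` fill up.
∈-products : (m : ℕ) (i₀ : Fin n) (σ : Permutation′ n) → ∣ support σ ∣ ≤ m →
  ∃[ ρ ] (ρ ∈ products n m × ρ ≈ σ)
∈-products {n} zero i₀ σ ∣σ∣≤0 = id , here refl , λ i →
  sym (decidable-stable (σ ⟨$⟩ʳ i ≟ i) λ moves → i∉∅ (∈-support⁺ σ moves))
  where
  i∉∅ : {i : Fin n} → i ∉ˢ support σ
  i∉∅ {i} i∈ = n≮0 (≤-trans (≤-trans (≤-reflexive (sym (∣⁅x⁆∣≡1 i)))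
    (p⊆q⇒∣p∣≤∣q∣ λ x∈ → subst (_∈ˢ support σ) (sym (x∈⁅y⁆⇒x≡y i x∈)) i∈)) ∣σ∣≤0)
∈-products (suc m) i₀ σ ∣σ∣≤1+m with any? (moves? σ)
... | yes (i , moves)
  with ∈-products m i₀ (σ ∘ₚ settler σ i) (s≤s⁻¹ (≤-trans (support-settle σ i moves) ∣σ∣≤1+m))
...   | ρ , ρ∈ , ρ≈ = ρ ∘ₚ settler σ i
  , ∈-cartesianProductWith⁺ _ (∈-pairs i (σ ⟨$⟩ʳ i)) ρ∈
  , λ x → trans (cong (settler σ i ⟨$⟩ʳ_) (ρ≈ x)) (transpose-involutive i (σ ⟨$⟩ʳ i) (σ ⟨$⟩ʳ x))
∈-products {n} (suc m) i₀ σ ∣σ∣≤1+m | no none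
  with ∈-products m i₀ id (≤-trans (support-id n) z≤n)
... | ρ , ρ∈ , ρ≈ = ρ ∘ₚ transpose i₀ i₀
  , ∈-cartesianProductWith⁺ _ (∈-pairs i₀ i₀) ρ∈
  , λ x → trans (transpose-trivial i₀ (ρ ⟨$⟩ʳ x)) (trans (ρ≈ x)
      (sym (decidable-stable (σ ⟨$⟩ʳ x ≟ x) λ moves → none (x , moves))))

-- Netlists computing functions on a set of inputs

atLeast : ℕ → List Bool → Bool
atLeast zero    _        = true
atLeast (suc k) []       = false
atLeast (suc k) (b ∷ bs) = (b ∧ atLeast k bs) ∨ atLeast (suc k) bs

-- Correctness is demanded only on the assignments `input a`; for `a` ranging over permutations
-- these are the permutation matrices.
module Netlists {A I : Set} (input : A → I → Bool) where

  record Netlist : Set where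
    constructor netlist
    field
      {gateCount} : ℕ
      gates       : Gates I gateCount

    Wire : Set
    Wire = I ⊎ Fin gateCount

    value : A → Wire → Bool
    value a = [ input a , evalGates gates (input a) ]

  open Netlist

  private
    variable
      N N′ : Netlist
      g h : A → Bool

  record Computed (N : Netlist) (g : A → Bool) : Set where
    constructor _,_
    field
      wire    : Wire N
      correct : ∀ a → value N a wire ≡ g a

  -- Inclusion of the computed functions rather than of gate lists: a new gate shifts the indices of
  -- the old ones, so wires are tracked by the functions they carry.
  _⊑_ : Netlist → Netlist → Set
  N ⊑ N′ = ∀ {g} → Computed N g → Computed N′ g

  infix 4 _⊑_ _⊑⟨_⟩_

  record _⊑⟨_⟩_ (N : Netlist) (c : ℕ) (N′ : Netlist) : Set where
    constructor extension
    field
      preserves : N ⊑ N′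
      cost      : gateCount N′ ≤ gateCount N + c

  open _⊑⟨_⟩_ public

  ⊑-refl : N ⊑⟨ c ⟩ N
  ⊑-refl = extension (λ p → p) (m≤m+n _ _)

  ⊑-trans : ∀ {N N′ N″} → N ⊑⟨ c ⟩ N′ → N′ ⊑⟨ d ⟩ N″ → N ⊑⟨ c + d ⟩ N″
  ⊑-trans {c} {d} {N} e e′ = extension (λ p → preserves e′ (preserves e p))
    (≤-trans (cost e′) (≤-trans (+-monoˡ-≤ d (cost e)) (≤-reflexive (+-assoc (gateCount N) c d))))

  ⊑-weaken : c ≤ d → N ⊑⟨ c ⟩ N′ → N ⊑⟨ d ⟩ N′
  ⊑-weaken {N = N} c≤d e = extension (preserves e) (≤-trans (cost e) (+-monoʳ-≤ (gateCount N) c≤d))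

  addGate : (N : Netlist) (G : Gate (Wire N)) →
    ∃[ N′ ] (N ⊑⟨ 1 ⟩ N′ × Computed N′ (λ a → evalGate (value N a) G))
  addGate N G = N₊ , extension kept (≤-reflexive (+-comm 1 (gateCount N))) , inj₂ zero , λ _ → refl
    where
    N₊ : Netlist
    N₊ = netlist (gates N ▷ G)
    kept : N ⊑ N₊
    kept (inj₁ i , eq) = inj₁ i , eq
    kept (inj₂ w , eq) = inj₂ (suc w) , eq

  -- Quantifying over all extensions of N makes this a formula of cost c over
  -- the wires of N, to be instantiated after other gates have been added.
  record Computable (N : Netlist) (c : ℕ) (g : A → Bool) : Set where
    constructor computable
    field
      compute : ∀ {N′} → N ⊑ N′ → ∃[ N″ ] (N′ ⊑⟨ c ⟩ N″ × Computed N″ g)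

  open Computable

  computed-cong : (∀ a → g a ≡ h a) → Computed N g → Computed N h
  computed-cong g≗h (w , eq) = w , λ a → trans (eq a) (g≗h a)

  computable-cong : (∀ a → g a ≡ h a) → Computable N c g → Computable N c h
  computable-cong g≗h comp .compute N⊑N′ with compute comp N⊑N′
  ... | N″ , e , done = N″ , e , computed-cong g≗h done

  computable-weaken : c ≤ d → Computable N c g → Computable N d g
  computable-weaken c≤d comp .compute N⊑N′ with compute comp N⊑N′
  ... | N″ , e , done = N″ , ⊑-weaken c≤d e , done

  computable-⊑ : N ⊑ N′ → Computable N c g → Computable N′ c g
  computable-⊑ N⊑N′ comp .compute N′⊑N″ = compute comp (λ p → N′⊑N″ (N⊑N′ p))

  computed⇒computable : Computed N g → Computable N c g
  computed⇒computable done .compute N⊑N′ = _ , ⊑-refl , N⊑N′ done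

  computable-const : (b : Bool) → Computable N 1 (λ _ → b)
  computable-const true  .compute {N′} _ = addGate N′ (AND [])
  computable-const false .compute {N′} _ = addGate N′ (OR [])

  computable-binary : (_·_ : Bool → Bool → Bool) →
    (∀ {N} (u v : Wire N) → ∃[ G ] (∀ a → evalGate (value N a) G ≡ value N a u · value N a v)) →
    Computable N c g → Computable N d h → Computable N (c + d + 1) (λ a → g a · h a)
  computable-binary _·_ gate G H .compute N⊑N′ with compute G N⊑N′
  ... | N₁ , e₁ , g∈N₁ with compute H (λ p → preserves e₁ (N⊑N′ p))
  ...   | N₂ , e₂ , (v , v≗h) with preserves e₂ g∈N₁
  ...     | u , u≗g with gate {N₂} u v
  ...       | G₃ , G₃≗ with addGate N₂ G₃
  ...         | N₃ , e₃ , done = N₃ , ⊑-trans (⊑-trans e₁ e₂) e₃ ,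
    computed-cong (λ a → trans (G₃≗ a) (cong₂ _·_ (u≗g a) (v≗h a))) done

  computable-∧ : Computable N c g → Computable N d h → Computable N (c + d + 1) (λ a → g a ∧ h a)
  computable-∧ = computable-binary _∧_
    λ {N} u v → AND (u ∷ v ∷ []) , λ a → cong (value N a u ∧_) (Bool.∧-identityʳ (value N a v))

  computable-∨ : Computable N c g → Computable N d h → Computable N (c + d + 1) (λ a → g a ∨ h a)
  computable-∨ = computable-binary _∨_
    λ {N} u v → OR (u ∷ v ∷ []) , λ a → cong (value N a u ∨_) (Bool.∨-identityʳ (value N a v))

  computable-any : (h : B → A → Bool) → (∀ x → Computable N c (h x)) → (xs : List B) →
    Computable N (1 + length xs * (c + 1)) (λ a → any (λ x → h x a) xs)
  computable-any h comp [] = computable-const false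
  computable-any {c = c} h comp (x ∷ xs) =
    computable-weaken (≤-reflexive rearrange) (computable-∨ (comp x) (computable-any h comp xs))
    where
    open ≡-Reasoning
    r = length xs * (c + 1)
    rearrange : c + (1 + r) + 1 ≡ 1 + (c + 1 + r)
    rearrange = begin
      c + (1 + r) + 1    ≡⟨ +-comm _ 1 ⟩
      1 + (c + (1 + r))  ≡⟨ cong suc (+-assoc c 1 r) ⟨
      1 + (c + 1 + r)    ∎

  -- Both recursive calls are compiled separately, giving at most `2p + 2 ≤ 4p` gates. The
  -- exponential cost is affordable since only `2s + 1` votes are counted.
  computable-atLeast : (h : B → A → Bool) (k : ℕ) {xs : List B} → All (λ x → Computed N (h x)) xs →
    Computable N (4 ^ length xs) (λ a → atLeast k (map (λ x → h x a) xs))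
  computable-atLeast h zero {xs} _ = computable-weaken (m^n>0 4 (length xs)) (computable-const true)
  computable-atLeast h (suc k) [] = computable-const false
  computable-atLeast {N = N} h (suc k) {x ∷ xs} (done ∷ dones) =
    computable-weaken bound
      (computable-∨ (computable-∧ (computed⇒computable {c = 0} done) (computable-atLeast h k dones))
                    (computable-atLeast h (suc k) dones))
    where
    open ≤-Reasoning
    p = 4 ^ length xs
    1≤p : 1 ≤ p
    1≤p = m^n>0 4 (length xs)
    bound : p + 1 + p + 1 ≤ p + (p + (p + (p + 0)))
    bound = begin
      p + 1 + p + 1          ≤⟨ +-mono-≤ (+-monoˡ-≤ p (+-monoʳ-≤ p 1≤p)) 1≤p ⟩
      p + p + p + p          ≡⟨ +-assoc (p + p) p p ⟩
      p + p + (p + p)        ≡⟨ +-assoc p p (p + p) ⟩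
      p + (p + (p + p))      ≡⟨ cong (λ q → p + (p + (p + q))) (+-identityʳ p) ⟨
      p + (p + (p + (p + 0)))  ∎

  -- Gives every listed function its own wire, so that later layers read it for free. The test `P?`
  -- serves to skip those members of `products n m` that move more than `m` points.
  compute-all : {P : B → Set} → Decidable P → (h : B → A → Bool) →
    (∀ x → P x → Computable N c (h x)) → (xs : List B) →
    ∃[ N′ ] (N ⊑⟨ length xs * c ⟩ N′ × (∀ {x} → x ∈ xs → P x → Computed N′ (h x)))
  compute-all P? h comp [] = _ , ⊑-refl , λ ()
  compute-all {N = N} {c = c} {P = P} P? h comp (x ∷ xs) with P? x
  ... | no ¬px with compute-all P? h comp xs
  ...   | N₁ , e₁ , dones = N₁ , ⊑-weaken (m≤n+m _ c) e₁ ,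
    λ { (here refl) px → contradiction px ¬px ; (there x∈xs) → dones x∈xs }
  compute-all {N = N} {c = c} {P = P} P? h comp (x ∷ xs) | yes px with compute (comp x px) (λ p → p)
  ... | N₁ , e₁ , done with compute-all P? h (λ y py → computable-⊑ (preserves e₁) (comp y py)) xs
  ...   | N₂ , e₂ , dones = N₂ , ⊑-trans e₁ e₂ ,
    λ { (here refl) _ → preserves e₂ done ; (there x∈xs) → dones x∈xs }

-- Majority decoding

atLeast-true : (h : A → Bool) (k : ℕ) (xs : List A) →
  k + length (filter (λ x → ¬? (h x Bool.≟ true)) xs) ≤ length xs → atLeast k (map h xs) ≡ true
atLeast-true h zero    xs       _   = refl
atLeast-true h (suc k) (x ∷ xs) enough with h x
... | true  rewrite atLeast-true h k xs (s≤s⁻¹ enough) = refl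
... | false = atLeast-true h (suc k) xs
  (s≤s⁻¹ (≤-trans (≤-reflexive (sym (+-suc (suc k) _))) enough))

atLeast-false : (h : A → Bool) (k : ℕ) (xs : List A) →
  length (filter (λ x → ¬? (h x Bool.≟ false)) xs) < k → atLeast k (map h xs) ≡ false
atLeast-false h (suc k) []       _   = refl
atLeast-false h (suc k) (x ∷ xs) few with h x
... | true  rewrite atLeast-false h k xs (s≤s⁻¹ few) =
  atLeast-false h (suc k) xs (≤-trans (n≤1+n _) few)
... | false = atLeast-false h (suc k) xs few

-- With at most `s` wrong votes out of `2s + 1`, the threshold `s + 1` is reached exactly when `b`
-- is true.
majority : (h : A → Bool) (b : Bool) (xs : List A) → length xs ≡ suc (s + s) →
  length (filter (λ x → ¬? (h x Bool.≟ b)) xs) ≤ s → atLeast (suc s) (map h xs) ≡ b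
majority {s = s} h true  xs len few = atLeast-true h (suc s) xs
  (≤-trans (s≤s (+-monoʳ-≤ s few)) (≤-reflexive (sym len)))
majority {s = s} h false xs len few = atLeast-false h (suc s) xs (s≤s few)

-- Bounding families of sensitive transpositions

AllPairs-lookup : {R : A → A → Set} → (∀ {x y} → R x y → R y x) → {xs : List A} → AllPairs R xs →
  ∀ i j → i ≢ j → R (lookup xs i) (lookup xs j)
AllPairs-lookup symm (r ∷ rs) zero    zero    i≢j = contradiction refl i≢j
AllPairs-lookup symm (r ∷ rs) zero    (suc j) i≢j = All.lookup r (∈-lookup j)
AllPairs-lookup symm (r ∷ rs) (suc i) zero    i≢j = symm (All.lookup r (∈-lookup i))
AllPairs-lookup symm (r ∷ rs) (suc i) (suc j) i≢j = AllPairs-lookup symm rs i j (i≢j ∘ cong suc)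

-- Induction on the distance `gap` to the bound: if `k` is not maximal, a larger witness has a
-- smaller gap. The double negation is there because `P` is not assumed decidable.
bounded⇒¬¬maximum : (P : ℕ → Set) (gap : ℕ) → (∀ l → P l → l ≤ gap + k) →
  P k → ¬ ¬ (∃[ m ] (IsMaximum P m × k ≤ m))
bounded⇒¬¬maximum {k} P zero      bound pk none = none (k , (pk , bound) , ≤-refl)
bounded⇒¬¬maximum {k} P (suc gap) bound pk none = none (k , (pk , maximal) , ≤-refl)
  where
  maximal : ∀ l → P l → l ≤ k
  maximal l pl = decidable-stable (l ≤? k) λ l≰k →
    bounded⇒¬¬maximum P gap
      (λ l′ pl′ → ≤-trans (bound l′ pl′)
        (≤-trans (≤-reflexive (sym (+-suc gap k))) (+-monoʳ-≤ gap (≰⇒> l≰k))))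
      pl
      (λ { (m , max , l≤m) → none (m , max , ≤-trans (<⇒≤ (≰⇒> l≰k)) l≤m) })

module _ {f : Permutation′ n → Bool} where

  open SensitiveFamily

  -- Choosing one moved point from each transposition is injective by disjointness. This crude bound
  -- guarantees a maximum.
  SensitiveFamily-size : {π : Permutation′ n} → SensitiveFamily f π k → k ≤ n
  SensitiveFamily-size fam = injective⇒≤ {f = moved} moved-injective
    where
    moved : Fin _ → Fin n
    moved a = proj₁ (transposition fam a)
    moved-moves : ∀ a → Moves (τ fam a) (moved a)
    moved-moves a fixed with transposition fam a
    ... | i , j , i≢j , τ≈ = i≢j (trans (sym fixed) (trans (τ≈ i) (transpose-left i j)))
    moved-injective : ∀ {a b} → moved a ≡ moved b → a ≡ b
    moved-injective {a} {b} eq = decidable-stable (a ≟ b) λ a≢b →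
      disjoint fam a b a≢b (moved a)
        (moved-moves a , subst (Moves (τ fam b)) (sym eq) (moved-moves b))

  -- The hypothesis speaks of exact maxima only, so `k` is compared with the maximum at `π`. Its
  -- double negation is harmless because the goal is decidable.
  SensitiveFamily-≤ : IsSensitivity f s → {π : Permutation′ n} → SensitiveFamily f π k → k ≤ s
  SensitiveFamily-≤ {s} {k} (_ , s-max) {π} fam = decidable-stable (k ≤? s) λ k≰s →
    bounded⇒¬¬maximum (SensitiveFamily f π) n
      (λ l fam′ → m≤n⇒m≤n+o k (SensitiveFamily-size fam′)) fam
      (λ { (m , max , k≤m) → k≰s (≤-trans k≤m (s-max m (π , max))) })

  sensitive-filter-≤ : IsSensitivity f s → (π : Permutation′ n) (τs : List (Permutation′ n)) →
    All IsTransposition τs → AllPairs Disjoint τs →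
    length (filter (λ τ → ¬? (f (π ∘ₚ τ) Bool.≟ f π)) τs) ≤ s
  sensitive-filter-≤ sens π τs transp disj = SensitiveFamily-≤ sens {π} record
    { τ             = lookup τs′
    ; transposition = λ a → All.lookup (All.filter⁺ sensitive? transp) (∈-lookup a)
    ; disjoint      = AllPairs-lookup (λ disj x → disj x ∘ swap) (AllPairs.filter⁺ sensitive? disj)
    ; sensitive     = λ a → All.lookup (All.all-filter sensitive? τs) (∈-lookup a)
    }
    where
    sensitive? : Decidable (λ τ → f (π ∘ₚ τ) ≢ f π)
    sensitive? τ = ¬? (f (π ∘ₚ τ) Bool.≟ f π)
    τs′ : List (Permutation′ n)
    τs′ = filter sensitive? τs

-- Moving the centre of the ball

-- The centre after the steps in the list, whose head is the latest step. The factor applied there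
-- carries the old image of `i` to `π i`.
path : List (Fin n) → Permutation′ n → Permutation′ n
path []       π = id
path (i ∷ is) π = path is π ∘ₚ transpose (path is π ⟨$⟩ʳ i) (π ⟨$⟩ʳ i)

-- Earlier agreements survive: at `j ≠ i` the common image differs from both swapped points, by
-- injectivity of the centre and of `π`.
path-agrees : (is : List (Fin n)) (π : Permutation′ n) {i : Fin n} → i ∈ is →
  path is π ⟨$⟩ʳ i ≡ π ⟨$⟩ʳ i
path-agrees (i ∷ is) π (here refl) = transpose-left (path is π ⟨$⟩ʳ i) (π ⟨$⟩ʳ i)
path-agrees (i ∷ is) π {j} (there j∈is) with i ≟ j
... | yes refl = transpose-left (path is π ⟨$⟩ʳ i) (π ⟨$⟩ʳ i)
... | no i≢j = trans
  (transpose-other (λ eq → i≢j (sym (⟨$⟩ʳ-injective (path is π) eq)))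
                   (λ eq → i≢j (sym (⟨$⟩ʳ-injective π (trans (sym agrees) eq)))))
  agrees
  where
  agrees : path is π ⟨$⟩ʳ j ≡ π ⟨$⟩ʳ j
  agrees = path-agrees is π j∈is

path-allFin : (π : Permutation′ n) → path (allFin n) π ≈ π
path-allFin π i = path-agrees (allFin _) π (∈-allFin i)

-- A multiplexer: the selectors `p` switch on only the branch at `x₀`.
any-select : (p h : B → Bool) (x₀ : B) (xs : List B) → x₀ ∈ xs → p x₀ ≡ true →
  (∀ x → p x ≡ true → x ≡ x₀) → any (λ x → p x ∧ h x) xs ≡ h x₀
any-select {B = B} p h x₀ xs x₀∈xs px₀ unique with h x₀ in hx₀
... | true = found xs x₀∈xs
  where
  found : (xs : List B) → x₀ ∈ xs → any (λ x → p x ∧ h x) xs ≡ true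
  found (x ∷ xs) (here refl) rewrite px₀ | hx₀ = refl
  found (x ∷ xs) (there x₀∈) rewrite found xs x₀∈ = Bool.∨-zeroʳ (p x ∧ h x)
... | false = absent xs
  where
  absent : (xs : List B) → any (λ x → p x ∧ h x) xs ≡ false
  absent [] = refl
  absent (x ∷ xs) with p x in px
  ... | false = absent xs
  ... | true rewrite unique x px | hx₀ = absent xs

does-≟-true : (i j : Fin n) → does (i ≟ j) ≡ true → i ≡ j
does-≟-true i j eq with yes i≡j ← i ≟ j = i≡j

∧-true : ∀ {b b′} → b ∧ b′ ≡ true → b ≡ true × b′ ≡ true
∧-true {true} {true} _ = refl , refl

-- Reads a position bit of the shifted centre off the old table: for constant `a` and `b`, the index
-- `transpose a b ⟨$⟩ʳ k` is a constant too.
does-≟-transpose : (x a b k : Fin n) →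
  does (x ≟ transpose a b ⟨$⟩ʳ k) ≡ does (transpose a b ⟨$⟩ʳ x ≟ k)
does-≟-transpose x a b k with x ≟ transpose a b ⟨$⟩ʳ k
... | yes refl = sym (dec-true (transpose a b ⟨$⟩ʳ (transpose a b ⟨$⟩ʳ k) ≟ k) (transpose-involutive a b k))
... | no x≢ = sym (dec-false (transpose a b ⟨$⟩ʳ x ≟ k) λ { refl → x≢ (sym (transpose-involutive a b x)) })

-- The circuit that walks the centre to the input

module Walk {n s : ℕ} (f : Permutation′ n → Bool) (f-resp : f Preserves _≈_ ⟶ _≡_)
  (sens : IsSensitivity f s) (i₀ : Fin n) (c X : ℕ)
  -- `c` is the budget for one table entry and `X` the budget for a whole table.
  (c≥1 : 1 ≤ c) (c≥majority : 4 ^ suc (s + s) ≤ c) (c≥select : 1 + n * n * 3 ≤ c)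
  (X≥ : ∀ m → m ≤ 2 + 3 * (s + s) → (n * n) ^ m * c ≤ X)
  where

  open Netlists (permutationMatrix {n})

  private
    variable
      N : Netlist

  -- Beyond three times `2s` moved points the greedy choice cannot stop before `2s + 1` disjoint
  -- settlers.
  radius : ℕ
  radius = 3 * (s + s)

  -- Wires for the permutation matrix of the current centre.
  Position : List (Fin n) → Netlist → Set
  Position is N = ∀ i j → Computed N (λ π → does (path is π ⟨$⟩ʳ i ≟ j))

  -- The offset `σ` is hardwired, while the centre depends on the input.
  Ball : ℕ → List (Fin n) → Netlist → Set
  Ball m is N = ∀ σ → ∣ support σ ∣ ≤ m → Computed N (λ π → f (path is π ∘ₚ σ))

  compute-positions : (is : List (Fin n)) → (∀ i j → Computable N c (λ π → does (path is π ⟨$⟩ʳ i ≟ j))) →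
    ∃[ N′ ] (N ⊑⟨ X ⟩ N′ × Position is N′)
  compute-positions is comp
    with compute-all (λ _ → yes tt) _ (λ { (i , j) _ → comp i j }) (pairs n)
  ... | N′ , e , done = N′ , ⊑-weaken bound e , λ i j → done (∈-pairs i j) tt
    where
    bound : length (pairs n) * c ≤ X
    bound = ≤-trans
      (≤-reflexive (cong (_* c) (trans (length-pairs n) (sym (*-identityʳ (n * n))))))
      (X≥ 1 (s≤s z≤n))

  -- Only listed representatives get wires; any other `σ` agrees pointwise with one of them, and `f`
  -- respects this.
  compute-ball : (is : List (Fin n)) → m ≤ 2 + radius →
    (∀ σ → ∣ support σ ∣ ≤ m → Computable N c (λ π → f (path is π ∘ₚ σ))) →
    ∃[ N′ ] (N ⊑⟨ X ⟩ N′ × Ball m is N′)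
  compute-ball {m} is m≤ comp
    with compute-all (λ σ → ∣ support σ ∣ ≤? m) _ comp (products n m)
  ... | N′ , e , done = N′ , ⊑-weaken bound e , ball
    where
    bound : length (products n m) * c ≤ X
    bound = ≤-trans (≤-reflexive (cong (_* c) (length-products n m))) (X≥ m m≤)
    ball : Ball m is N′
    ball σ small with ∈-products m i₀ σ small
    ... | ρ , ρ∈ , ρ≈σ = computed-cong
      (λ π → f-resp (λ i → ρ≈σ (path is π ⟨$⟩ʳ i)))
      (done ρ∈ (≤-trans (p⊆q⇒∣p∣≤∣q∣ ρ⊆σ) small))
      where
      ρ⊆σ : support ρ ⊆ support σ
      ρ⊆σ {x} x∈ = ∈-support⁺ σ λ σx≡x → ∈-support⁻ ρ x∈ (trans (ρ≈σ x) σx≡x)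

  settlers-majority : (ρ σ : Permutation′ n) {is : List (Fin n)} → length is ≡ suc (s + s) →
    All (Moves σ) is → AllPairs (SettlersDisjoint σ) is →
    atLeast (suc s) (map (λ i → f (ρ ∘ₚ (σ ∘ₚ settler σ i))) is) ≡ f (ρ ∘ₚ σ)
  settlers-majority ρ σ {is} len moves disjoint = begin
    atLeast (suc s) (map (λ i → f (ρ ∘ₚ (σ ∘ₚ settler σ i))) is)
      ≡⟨ cong (atLeast (suc s)) (map-cong (λ i → f-resp λ _ → refl) is) ⟩
    atLeast (suc s) (map (λ i → f ((ρ ∘ₚ σ) ∘ₚ settler σ i)) is)
      ≡⟨ cong (atLeast (suc s)) (map-∘ is) ⟩
    atLeast (suc s) (map (λ τ → f ((ρ ∘ₚ σ) ∘ₚ τ)) (map (settler σ) is))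
      ≡⟨ majority _ (f (ρ ∘ₚ σ)) (map (settler σ) is) (trans (length-map (settler σ) is) len)
           (sensitive-filter-≤ sens (ρ ∘ₚ σ) (map (settler σ) is)
             (All.map⁺ (All.map (settler-transposition σ) moves))
             (AllPairs.map⁺ disjoint)) ⟩
    f (ρ ∘ₚ σ) ∎
    where open ≡-Reasoning

  enlarge : (is : List (Fin n)) → radius ≤ m → suc m ≤ 2 + radius → Ball m is N →
    ∃[ N′ ] (N ⊑⟨ X ⟩ N′ × Ball (suc m) is N′)
  enlarge {m} {N} is radius≤m 1+m≤ ball = compute-ball is 1+m≤ comp
    where
    comp : ∀ σ → ∣ support σ ∣ ≤ suc m → Computable N c (λ π → f (path is π ∘ₚ σ))
    comp σ small with settlers σ (suc (s + s))
    -- Cancelling 3 from `3 + ∣ support σ ∣ ≤ 3 * suc (s + s)` leaves `∣ support σ ∣ ≤ radius`, so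
    -- the value is already on a wire.
    ... | inj₂ smaller = computed⇒computable (ball σ (≤-trans (+-cancelˡ-≤ 3 _ _
      (≤-trans smaller (≤-reflexive (*-suc 3 (s + s))))) radius≤m))
    ... | inj₁ (js , len , moves , disjoint) = computable-weaken
      (≤-trans (≤-reflexive (cong (4 ^_) len)) c≥majority)
      (computable-cong (λ π → settlers-majority (path is π) σ len moves disjoint)
        (computable-atLeast _ (suc s) (All.map closer moves)))
      where
      closer : ∀ {j} → Moves σ j → Computed N (λ π → f (path is π ∘ₚ (σ ∘ₚ settler σ j)))
      closer {j} moves-j = ball (σ ∘ₚ settler σ j) (s≤s⁻¹ (≤-trans (support-settle σ j moves-j) small))

  -- The transposition applied at step i is the unique one selected by the bits
  -- [path is π i = a] and [π i = b].
  computable-step : (is : List (Fin n)) (g : Permutation′ n → Bool) (i : Fin n) → Position is N →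
    (∀ a b → Computed N (λ π → g (path is π ∘ₚ transpose a b))) →
    Computable N c (λ π → g (path (i ∷ is) π))
  computable-step is g i pos comp = computable-weaken bound
    (computable-cong selected
      (computable-any branch
        (λ { (a , b) → computable-∧
          (computable-∧ (computed⇒computable {c = 0} (pos i a))
                        (computed⇒computable {c = 0} (inj₁ (i , b) , λ _ → refl)))
          (computed⇒computable {c = 0} (comp a b)) })
        (pairs n)))
    where
    select : Permutation′ n → Fin n × Fin n → Bool
    select π (a , b) = does (path is π ⟨$⟩ʳ i ≟ a) ∧ does (π ⟨$⟩ʳ i ≟ b)
    branch : Fin n × Fin n → Permutation′ n → Bool
    branch (a , b) π = select π (a , b) ∧ g (path is π ∘ₚ transpose a b)
    selected : ∀ π → any (λ x → branch x π) (pairs n) ≡ g (path (i ∷ is) π)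
    selected π = any-select (select π) (λ { (a , b) → g (path is π ∘ₚ transpose a b) })
      (path is π ⟨$⟩ʳ i , π ⟨$⟩ʳ i) (pairs n) (∈-pairs _ _)
      (cong₂ _∧_ (dec-true (path is π ⟨$⟩ʳ i ≟ path is π ⟨$⟩ʳ i) refl)
                 (dec-true (π ⟨$⟩ʳ i ≟ π ⟨$⟩ʳ i) refl))
      (λ { (a , b) eq → cong₂ _,_ (sym (does-≟-true _ a (proj₁ (∧-true eq))))
                                  (sym (does-≟-true _ b (proj₂ (∧-true {does (path is π ⟨$⟩ʳ i ≟ a)} eq)))) })
    -- Each pair takes two AND gates and one OR gate; the leading 1 is the constant ending the
    -- disjunction.
    bound : 1 + length (pairs n) * 3 ≤ c
    bound = ≤-trans (≤-reflexive (cong (λ l → 1 + l * 3) (length-pairs n))) c≥select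

  -- Opaque because abstracting over a call would normalise the whole netlist.
  abstract
    step : (i : Fin n) (is : List (Fin n)) → Position is N → Ball radius is N →
      ∃[ N′ ] (N ⊑⟨ (X + X) + (X + X) ⟩ N′ × Position (i ∷ is) N′ × Ball radius (i ∷ is) N′)
    step i is pos ball with enlarge is ≤-refl (n≤1+n _) ball
    -- A second enlargement, because a transposition can add two moved points.
    ... | N₁ , e₁ , ball₁ with enlarge is (n≤1+n _) ≤-refl ball₁
    ... | N₂ , e₂ , ball₂ with compute-positions (i ∷ is) (λ j k →
            computable-step is (λ ρ → does (ρ ⟨$⟩ʳ j ≟ k)) i
              (λ a b → preserves e₂ (preserves e₁ (pos a b)))
              (λ a b → computed-cong
                (λ π → does-≟-transpose (path is π ⟨$⟩ʳ j) a b k)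
                (preserves e₂ (preserves e₁ (pos j (transpose a b ⟨$⟩ʳ k))))))
    -- In the branch `(a , b)` the transposition is absorbed into the offset, which stays within the
    -- enlarged ball around the old centre.
    ... | N₃ , e₃ , pos₃ with compute-ball (i ∷ is) (m≤n+m radius 2) (λ σ small →
            computable-⊑ (preserves e₃) (computable-step is (λ ρ → f (ρ ∘ₚ σ)) i
              (λ a b → preserves e₂ (preserves e₁ (pos a b)))
              (λ a b → computed-cong (λ π → f-resp λ _ → refl)
                (ball₂ (transpose a b ∘ₚ σ)
                  (≤-trans (support-transpose-∘ₚ a b σ) (s≤s (s≤s small)))))))
    ... | N₄ , e₄ , ball₄ = N₄ , ⊑-trans (⊑-trans e₁ e₂) (⊑-trans e₃ e₄)
      , (λ j k → preserves e₄ (pos₃ j k)) , ball₄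

  -- The first centre is the identity whatever the input, so all table entries are constants.
  start : ∃[ N ] (Netlist.gateCount N ≤ (X + X) + 0 × Position [] N × Ball radius [] N)
  start with compute-positions {N = netlist []} []
    (λ i j → computable-weaken c≥1 (computable-const (does (i ≟ j))))
  ... | N₁ , e₁ , pos with compute-ball {N = N₁} [] (m≤n+m radius 2)
    (λ σ _ → computable-weaken c≥1 (computable-cong (λ _ → f-resp {σ} {id ∘ₚ σ} λ _ → refl)
      (computable-const (f σ))))
  ... | N₂ , e₂ , ball = N₂
    , ≤-trans (cost (⊑-trans e₁ e₂)) (m≤m+n (X + X) 0)
    , (λ i j → preserves e₂ (pos i j)) , ball

  walk : (is : List (Fin n)) → ∃[ N ]
    (Netlist.gateCount N ≤ (X + X) + length is * ((X + X) + (X + X)) × Position is N × Ball radius is N)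
  walk [] = start
  walk (i ∷ is) with walk is
  ... | N , size≤ , pos , ball with step i is pos ball
  ... | N′ , e , pos′ , ball′ = N′ , bound , pos′ , ball′
    where
    open ≤-Reasoning
    Y = (X + X) + (X + X)
    bound : Netlist.gateCount N′ ≤ (X + X) + (Y + length is * Y)
    bound = begin
      Netlist.gateCount N′                ≤⟨ cost e ⟩
      Netlist.gateCount N + Y             ≤⟨ +-monoˡ-≤ Y size≤ ⟩
      (X + X) + length is * Y + Y         ≡⟨ +-assoc (X + X) (length is * Y) Y ⟩
      (X + X) + (length is * Y + Y)       ≡⟨ cong ((X + X) +_) (+-comm (length is * Y) Y) ⟩
      (X + X) + (Y + length is * Y)       ∎

  circuit : ∃[ C ] (Computes C f × size C ≤ (X + X) + n * ((X + X) + (X + X)))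
  circuit with walk (allFin n)
  -- The centre has reached `π`, so the entry at offset `id` is `f π`.
  ... | N , size≤ , _ , ball with ball id (≤-trans (support-id n) z≤n)
  ... | out , correct = record { gates = Netlist.gates N ; output = out }
    , (λ π → trans (correct π) (f-resp (path-allFin π)))
    , subst (λ l → Netlist.gateCount N ≤ (X + X) + l * ((X + X) + (X + X)))
        (length-tabulate {n = n} λ i → i) size≤

-- A transposition changing `f` would be a sensitive family of size one, so `f` is constant along
-- the path from `id` to `π`.
insensitive⇒constant : (f : Permutation′ n → Bool) → f Preserves _≈_ ⟶ _≡_ →
  IsSensitivity f 0 → ∀ π → f π ≡ f id
insensitive⇒constant {n} f f-resp sens π =
  trans (f-resp (λ i → sym (path-allFin π i))) (along (allFin n))
  where
  insensitive : ∀ ρ i j → f (ρ ∘ₚ transpose i j) ≡ f ρ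
  insensitive ρ i j with i ≟ j
  ... | yes refl = f-resp (λ x → transpose-trivial i (ρ ⟨$⟩ʳ x))
  ... | no i≢j = decidable-stable (f (ρ ∘ₚ transpose i j) Bool.≟ f ρ) λ sensitive →
    n≮0 (SensitiveFamily-≤ {k = 1} sens {ρ} record
      { τ             = λ _ → transpose i j
      ; transposition = λ _ → i , j , i≢j , λ _ → refl
      ; disjoint      = λ { zero zero 0≢0 → contradiction refl 0≢0 }
      ; sensitive     = λ _ → sensitive
      })
  along : (is : List (Fin n)) → f (path is π) ≡ f id
  along []       = refl
  along (i ∷ is) = trans (insensitive (path is π) _ _) (along is)

-- Arithmetic of the size bound

module Bounds (n : ℕ) (2≤n : 2 ≤ n) where

  q : ℕ
  q = n * n

  4≤q : 4 ≤ q
  4≤q = *-mono-≤ 2≤n 2≤n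

  instance
    q≢0 : NonZero q
    q≢0 = >-nonZero (≤-trans (s≤s z≤n) 4≤q)

    n≢0 : NonZero n
    n≢0 = >-nonZero (≤-trans (s≤s z≤n) 2≤n)

  functionCost : ℕ → ℕ
  functionCost s = q ^ suc (s + s)

  layerCost : ℕ → ℕ
  layerCost s = q ^ (2 + 3 * (s + s)) * functionCost s

  majority-bound : ∀ s → 4 ^ suc (s + s) ≤ functionCost s
  majority-bound s = ^-monoˡ-≤ (suc (s + s)) 4≤q

  -- Positive `s` makes the exponent at least 2; for `s = 0` the right side would be just `q`.
  select-bound : ∀ s → 1 ≤ s → 1 + q * 3 ≤ functionCost s
  select-bound s 1≤s = begin
    1 + q * 3    ≤⟨ +-monoˡ-≤ (q * 3) (≤-trans (s≤s z≤n) 4≤q) ⟩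
    q + q * 3    ≡⟨ *-suc q 3 ⟨
    q * 4        ≤⟨ *-monoʳ-≤ q 4≤q ⟩
    q * q        ≡⟨ cong (q *_) (*-identityʳ q) ⟨
    q ^ 2        ≤⟨ ^-monoʳ-≤ q (s≤s (≤-trans 1≤s (m≤m+n s s))) ⟩
    q ^ suc (s + s)  ∎
    where open ≤-Reasoning

  layer-bound : ∀ s m → m ≤ 2 + 3 * (s + s) → q ^ m * functionCost s ≤ layerCost s
  layer-bound s m m≤ = *-monoˡ-≤ (functionCost s) (^-monoʳ-≤ q m≤)

  -- Two tables at the start and four per step; `2 ≤ n` and `4 ≤ q` absorb the constants into two
  -- factors `q`.
  layers-bound : ∀ X → (X + X) + n * ((X + X) + (X + X)) ≤ q * (q * X)
  layers-bound X = begin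
    (X + X) + n * Y    ≤⟨ +-monoˡ-≤ (n * Y) (≤-trans (m≤m+n (X + X) (X + X)) (m≤n*m Y n)) ⟩
    n * Y + n * Y      ≡⟨ cong (n * Y +_) (+-identityʳ (n * Y)) ⟨
    2 * (n * Y)        ≤⟨ *-monoˡ-≤ (n * Y) 2≤n ⟩
    n * (n * Y)        ≡⟨ *-assoc n n Y ⟨
    q * Y              ≡⟨ cong (q *_) (solve 1 (λ x → (x :+ x) :+ (x :+ x) := con 4 :* x) refl X) ⟩
    q * (4 * X)        ≤⟨ *-monoʳ-≤ q (*-monoˡ-≤ X 4≤q) ⟩
    q * (q * X)        ∎
    where
    open ≤-Reasoning
    open +-*-Solver
    Y = (X + X) + (X + X)

  exponent-bound : ∀ s → 1 ≤ s → 2 + ((2 + 3 * (s + s)) + suc (s + s)) ≤ 13 * s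
  exponent-bound s 1≤s = begin
    2 + ((2 + 3 * (s + s)) + suc (s + s))
      ≡⟨ solve 1 (λ x → con 2 :+ ((con 2 :+ con 3 :* (x :+ x)) :+ (con 1 :+ (x :+ x)))
                       := con 5 :* con 1 :+ con 8 :* x) refl s ⟩
    5 * 1 + 8 * s  ≤⟨ +-monoˡ-≤ (8 * s) (*-monoʳ-≤ 5 1≤s) ⟩
    5 * s + 8 * s  ≡⟨ *-distribʳ-+ s 5 8 ⟨
    13 * s         ∎
    where
    open ≤-Reasoning
    open +-*-Solver

  size-bound : ∀ s → 1 ≤ s → q * (q * layerCost s) ≤ n ^ (26 * s)
  size-bound s 1≤s = begin
    q * (q * (q ^ a * q ^ b))  ≡⟨ cong (λ p → q * (q * p)) (^-distribˡ-+-* q a b) ⟨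
    q ^ (2 + (a + b))          ≤⟨ ^-monoʳ-≤ q (exponent-bound s 1≤s) ⟩
    q ^ (13 * s)               ≡⟨ cong (λ m → (n * m) ^ (13 * s)) (*-identityʳ n) ⟨
    (n ^ 2) ^ (13 * s)         ≡⟨ ^-*-assoc n 2 (13 * s) ⟩
    n ^ (2 * (13 * s))         ≡⟨ cong (n ^_) (*-assoc 2 13 s) ⟨
    n ^ (26 * s)               ∎
    where
    open ≤-Reasoning
    a = 2 + 3 * (s + s)
    b = suc (s + s)

theorem1p3 : ∃[ K ] (∀ (n : ℕ) → 2 ≤ n →
    ∀ (f : Permutation′ n → Bool) → f Preserves _≈_ ⟶ _≡_ →
    ∀ (s : ℕ) → IsSensitivity f s →
    ∃[ C ] (Computes C f × size C ≤ n ^ (K * s)))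
-- The exponent of `q` is `8s + 5 ≤ 13s` for positive `s`, and `q` is the square of `n`.
theorem1p3 = 26 , bounded
  where
  bounded : ∀ n → 2 ≤ n → (f : Permutation′ n → Bool) → f Preserves _≈_ ⟶ _≡_ →
    ∀ s → IsSensitivity f s → ∃[ C ] (Computes C f × size C ≤ n ^ (26 * s))
  bounded n 2≤n f f-resp zero sens =
    -- Here the bound is `n ^ 0 = 1`: one gate for a constant.
    constant-circuit (computable-const (f id) .compute {netlist []} λ p → p)
    where
    open Netlists (permutationMatrix {n})
    open Computable
    constant-circuit : ∃[ N ] (netlist [] ⊑⟨ 1 ⟩ N × Computed N (λ _ → f id)) →
      ∃[ C ] (Computes C f × size C ≤ 1)
    constant-circuit (N , e , (w , correct)) = record { gates = Netlist.gates N ; output = w }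
      , (λ π → trans (correct π) (sym (insensitive⇒constant f f-resp sens π)))
      , cost e
  bounded n 2≤n f f-resp s@(suc _) sens =
    map₂ (map₂ λ C-size → ≤-trans C-size
        (≤-trans (layers-bound (layerCost s)) (size-bound s (s≤s z≤n))))
      circuit
    where
    open Bounds n 2≤n
    open Walk f f-resp sens (fromℕ< 2≤n) (functionCost s) (layerCost s)
      (m^n>0 q (suc (s + s))) (majority-bound s) (select-bound s (s≤s z≤n)) (layer-bound s)
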